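{- Let $S$ be one of CK, ID, MP, ID+MP, and let the corresponding conditional system be CK, CK+ID, CK+MP, CK+MP+ID respectively. If a sequent $\Gamma \vdash \Delta$ is derivable in the calculus Seq$S$, then $\Gamma \vdash \Delta$ is valid in the corresponding system.
   Context: Formulas are built from propositional variables (a set $ATM$) and $\bot$ by the binary connectives $\to$ and $\Rightarrow$. Semantics. A (selection function) model is $\mathcal{M}=\langle \mathcal{W}, f, [\,]\rangle$ with $\mathcal{W}\neq\emptyset$ a set of worlds, $f:\mathcal{W}\times 2^{\mathcal{W}}\to 2^{\mathcal{W}}$, and $[\,]$ assigning to each $P\in ATM$ a subset $[P]\subseteq\mathcal{W}$, extended by $[\bot]=\emptyset$, $[A\to B]=(\mathcal{W}\setminus[A])\cup[B]$, $[A\Rightarrow B]=\{w\in\mathcal{W}: f(w,[A])\subseteq[B]\}$. System CK: all models. CK+ID: models with $f(w,[A])\subseteq[A]$ for all worlds $w$ and formulas $A$. CK+MP: models such that $w\in[A]$ implies $w\in f(w,[A])$ for all $w$, $A$. CK+MP+ID: models satisfying both conditions. Sequents. Fix a denumerable set $\mathcal{A}$ of labels. A labelled formula is $x:A$ and a transition formula is $x\xrightarrow{A}y$, with $x,y\in\mathcal{A}$ and $A$ a formula. A sequent $\Gamma\vdash\Delta$ is a pair of finite multisets of labelled and transition formulas. For a model $\mathcal{M}$ and a map $I:\mathcal{A}\to\mathcal{W}$: $\mathcal{M}\models_I x:A$ iff $I(x)\in[A]$; $\mathcal{M}\models_I x\xrightarrow{A}y$ iff $I(y)\in f(I(x),[A])$.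 $\Gamma\vdash\Delta$ is valid in $\mathcal{M}$ if for every $I$, whenever $\mathcal{M}\models_I F$ for all $F\in\Gamma$, then $\mathcal{M}\models_I G$ for some $G\in\Delta$. It is valid in a system if it is valid in every model of that system. Calculus Seq$S$ ($F$ is any labelled or transition formula): (AX) axiom $\Gamma,F\vdash\Delta,F$. (A$\bot$) axiom $\Gamma,x:\bot\vdash\Delta$. (Weak L) from $\Gamma\vdash\Delta$ infer $\Gamma,F\vdash\Delta$. (Weak R) from $\Gamma\vdash\Delta$ infer $\Gamma\vdash\Delta,F$. (Contr L) from $\Gamma,F,F\vdash\Delta$ infer $\Gamma,F\vdash\Delta$. (Contr R) from $\Gamma\vdash\Delta,F,F$ infer $\Gamma\vdash\Delta,F$. ($\to$R) from $\Gamma,x:A\vdash x:B,\Delta$ infer $\Gamma\vdash x:A\to B,\Delta$. ($\to$L) from $\Gamma\vdash x:A,\Delta$ and $\Gamma,x:B\vdash\Delta$ infer $\Gamma,x:A\to B\vdash\Delta$. (EQ) from $u:A\vdash u:B$ and $u:B\vdash u:A$ infer $\Gamma,x\xrightarrow{A}y\vdash x\xrightarrow{B}y,\Delta$. ($\Rightarrow$L) from $\Gamma\vdash x\xrightarrow{A}y,\Delta$ and $\Gamma,y:B\vdash\Delta$ infer $\Gamma,x:A\Rightarrow B\vdash\Delta$. ($\Rightarrow$R) from $\Gamma,x\xrightarrow{A}y\vdash y:B,\Delta$ infer $\Gamma\vdash x:A\Rightarrow B,\Delta$, where the label $y$ does not occur in $\Gamma,\Delta$ and $y\neq x$. (ID)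 (only in SeqID and SeqID+MP) from $\Gamma,y:A\vdash\Delta$ infer $\Gamma,x\xrightarrow{A}y\vdash\Delta$. (MP) (only in SeqMP and SeqID+MP) from $\Gamma\vdash x:A,\Delta$ infer $\Gamma\vdash x\xrightarrow{A}x,\Delta$. -}

module Defs where

open import Data.List using (List; []; _∷_)
open import Data.List.Relation.Binary.Permutation.Propositional using (_↭_)
open import Data.List.Relation.Unary.All using (All)
open import Data.List.Relation.Unary.Any using (Any)
open import Data.Product using (_×_)
open import Data.Unit.Polymorphic using (⊤)
open import Level using (Level; _⊔_; suc)
open import Relation.Binary.PropositionalEquality using (_≢_)
open import Relation.Nullary using (¬_)
open import Relation.Unary using (Pred; _∈_; _⊆_; _≐_; _∪_; ∁)
open import Relation.Unary.Polymorphic using (∅)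

private
  variable
    a b ℓ : Level

infixr 7 _⊃_ _⇒_
infix  6 _∶_ _⟶[_]_
infix  3 _⊢_

-- _⊃_ is the material implication A → B (the arrow itself is reserved);
-- _⇒_ is the conditional.
data Formula (Atm : Set a) : Set a where
  var : Atm → Formula Atm
  bot : Formula Atm
  _⊃_ : Formula Atm → Formula Atm → Formula Atm
  _⇒_ : Formula Atm → Formula Atm → Formula Atm

-- Subsets of W are predicates.  Since 2^W is extensional, the selection
-- function has to respect extensional equality _≐_ of its set argument.
record Model (Atm : Set a) (ℓ : Level) : Set (a ⊔ suc ℓ) where
  field
    W        : Set ℓ
    nonempty : W
    f        : W → Pred W ℓ → Pred W ℓ
    f-cong   : ∀ w {X Y : Pred W ℓ} → X ≐ Y → f w X ≐ f w Y
    val      : Atm → Pred W ℓ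

  ⟦_⟧ : Formula Atm → Pred W ℓ
  ⟦ var P ⟧ = val P
  ⟦ bot ⟧   = ∅
  ⟦ A ⊃ B ⟧ = ∁ ⟦ A ⟧ ∪ ⟦ B ⟧
  ⟦ A ⇒ B ⟧ = λ w → f w ⟦ A ⟧ ⊆ ⟦ B ⟧

data System : Set where
  CK ID MP ID+MP : System

module _ {Atm : Set a} (M : Model Atm ℓ) where
  open Model M

  CondID : Set (a ⊔ ℓ)
  CondID = ∀ w (A : Formula Atm) → f w ⟦ A ⟧ ⊆ ⟦ A ⟧

  CondMP : Set (a ⊔ ℓ)
  CondMP = ∀ w (A : Formula Atm) → w ∈ ⟦ A ⟧ → w ∈ f w ⟦ A ⟧

  ModelOf : System → Set (a ⊔ ℓ)
  ModelOf CK    = ⊤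
  ModelOf ID    = CondID
  ModelOf MP    = CondMP
  ModelOf ID+MP = CondMP × CondID

data LFormula (Atm : Set a) (Label : Set b) : Set (a ⊔ b) where
  _∶_    : Label → Formula Atm → LFormula Atm Label
  _⟶[_]_ : Label → Formula Atm → Label → LFormula Atm Label

-- Finite multisets are lists up to permutation; see the rule exch below.
record Sequent (Atm : Set a) (Label : Set b) : Set (a ⊔ b) where
  constructor _⊢_
  field
    antecedent : List (LFormula Atm Label)
    succedent  : List (LFormula Atm Label)

data _OccursIn_ {Atm : Set a} {Label : Set b} (y : Label) :
                LFormula Atm Label → Set (a ⊔ b) where
  label  : ∀ {A}   → y OccursIn (y ∶ A)
  source : ∀ {A x} → y OccursIn (y ⟶[ A ] x)
  target : ∀ {A x} → y OccursIn (x ⟶[ A ] y)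

_∉labels_ : {Atm : Set a} {Label : Set b} → Label → List (LFormula Atm Label) → Set (a ⊔ b)
y ∉labels Γ = ¬ Any (y OccursIn_) Γ

module _ {Atm : Set a} {Label : Set b} (M : Model Atm ℓ) where
  open Model M

  Satisfies : (Label → W) → LFormula Atm Label → Set ℓ
  Satisfies I (x ∶ A)      = I x ∈ ⟦ A ⟧
  Satisfies I (x ⟶[ A ] y) = I y ∈ f (I x) ⟦ A ⟧

  ValidInModel : Sequent Atm Label → Set (a ⊔ b ⊔ ℓ)
  ValidInModel (Γ ⊢ Δ) = ∀ I → All (Satisfies I) Γ → Any (Satisfies I) Δ

ValidIn : {Atm : Set a} {Label : Set b} (ℓ : Level) →
          System → Sequent Atm Label → Set (a ⊔ b ⊔ suc ℓ)
ValidIn {Atm = Atm} ℓ S σ = (M : Model Atm ℓ) → ModelOf M S → ValidInModel M σ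

data HasID : System → Set where
  ID    : HasID ID
  ID+MP : HasID ID+MP

data HasMP : System → Set where
  MP    : HasMP MP
  ID+MP : HasMP ID+MP

data Derivable {Atm : Set a} {Label : Set b} (S : System) :
               Sequent Atm Label → Set (a ⊔ b) where

  -- Not a rule of the calculus proper: it identifies lists that represent
  -- the same multiset, so that the other rules may act on the list heads.
  exch : ∀ {Γ Γ′ Δ Δ′} → Γ ↭ Γ′ → Δ ↭ Δ′ →
         Derivable S (Γ ⊢ Δ) → Derivable S (Γ′ ⊢ Δ′)

  ax : ∀ {Γ Δ F} → Derivable S (F ∷ Γ ⊢ F ∷ Δ)

  a⊥ : ∀ {Γ Δ x} → Derivable S (x ∶ bot ∷ Γ ⊢ Δ)

  weakL : ∀ {Γ Δ F} → Derivable S (Γ ⊢ Δ) → Derivable S (F ∷ Γ ⊢ Δ)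

  weakR : ∀ {Γ Δ F} → Derivable S (Γ ⊢ Δ) → Derivable S (Γ ⊢ F ∷ Δ)

  contrL : ∀ {Γ Δ F} → Derivable S (F ∷ F ∷ Γ ⊢ Δ) → Derivable S (F ∷ Γ ⊢ Δ)

  contrR : ∀ {Γ Δ F} → Derivable S (Γ ⊢ F ∷ F ∷ Δ) → Derivable S (Γ ⊢ F ∷ Δ)

  ⊃R : ∀ {Γ Δ x A B} →
       Derivable S (x ∶ A ∷ Γ ⊢ x ∶ B ∷ Δ) →
       Derivable S (Γ ⊢ x ∶ A ⊃ B ∷ Δ)

  ⊃L : ∀ {Γ Δ x A B} →
       Derivable S (Γ ⊢ x ∶ A ∷ Δ) →
       Derivable S (x ∶ B ∷ Γ ⊢ Δ) →
       Derivable S (x ∶ A ⊃ B ∷ Γ ⊢ Δ)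

  eq : ∀ {Γ Δ A B} {u x y : Label} →
       Derivable S (u ∶ A ∷ [] ⊢ u ∶ B ∷ []) →
       Derivable S (u ∶ B ∷ [] ⊢ u ∶ A ∷ []) →
       Derivable S (x ⟶[ A ] y ∷ Γ ⊢ x ⟶[ B ] y ∷ Δ)

  ⇒L : ∀ {Γ Δ x y A B} →
       Derivable S (Γ ⊢ x ⟶[ A ] y ∷ Δ) →
       Derivable S (y ∶ B ∷ Γ ⊢ Δ) →
       Derivable S (x ∶ A ⇒ B ∷ Γ ⊢ Δ)

  ⇒R : ∀ {Γ Δ x y A B} →
       y ∉labels Γ → y ∉labels Δ → y ≢ x →
       Derivable S (x ⟶[ A ] y ∷ Γ ⊢ y ∶ B ∷ Δ) →
       Derivable S (Γ ⊢ x ∶ A ⇒ B ∷ Δ)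

  id : ∀ {Γ Δ x y A} → HasID S →
       Derivable S (y ∶ A ∷ Γ ⊢ Δ) →
       Derivable S (x ⟶[ A ] y ∷ Γ ⊢ Δ)

  mp : ∀ {Γ Δ x A} → HasMP S →
       Derivable S (Γ ⊢ x ∶ A ∷ Δ) →
       Derivable S (Γ ⊢ x ⟶[ A ] x ∷ Δ)

{-# OPTIONS --safe #-}

-- Each rule preserves validity in every model of the system.  The eigenvariable
-- rule ⇒R is handled by reinterpreting y as an arbitrary v ∈ f (I x) ⟦ A ⟧,
-- which does not affect Γ, Δ and x.
module Submission where

open import Defs
open import Axiom.ExcludedMiddle using (ExcludedMiddle)
open import Data.Empty using (⊥-elim)
open import Data.List using (List; []; _∷_)
open import Data.List.Relation.Binary.Permutation.Propositional using (↭-sym)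
open import Data.List.Relation.Binary.Permutation.Propositional.Properties
  using (All-resp-↭; Any-resp-↭)
open import Data.List.Relation.Unary.All using (All; []; _∷_)
open import Data.List.Relation.Unary.Any using (Any; here; there; any?)
open import Data.Nat using (ℕ)
import Data.Nat.Properties as ℕ
open import Data.Product using (_,_; proj₁; proj₂)
open import Data.Sum using (inj₁; inj₂)
open import Function.Base using (_∘_; const)
open import Function.Bundles using (_↔_)
open import Function.Properties.Inverse using (↔⇒↣)
open import Level using (Level)
open import Relation.Binary.Definitions using (DecidableEquality)
open import Relation.Binary.PropositionalEquality using (_≡_; _≢_; refl; sym; subst; subst₂)
open import Relation.Nullary using (¬_; yes; no)
open import Relation.Nullary.Decidable using (via-injection)
open import Relation.Unary using (_⊆_)

-- Soundness is an induction on derivations inside one fixed model, with the interpretation `I` of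
-- the labels left arbitrary: `eq` and `⇒R` call the induction hypothesis at interpretations other
-- than the current one. Two facts carry these cases. Satisfaction of a formula depends only on the
-- labels occurring in it (`Satisfies-agree`), so moving a fresh label changes nothing in the
-- context. A valid context-free sequent about one label is an inclusion of truth sets (`valid⇒⊆`),
-- so the premises of `eq` give equal sets, which `f` cannot tell apart. Excluded middle serves the
-- classical rules `⊃R` and `⇒R`.

private
  variable
    a b ℓ : Level

module Update {Label : Set b} (_≟_ : DecidableEquality Label) {W : Set ℓ} where

  _[_↦_] : (Label → W) → Label → W → Label → W
  (I [ y ↦ v ]) z with z ≟ y
  ... | yes _ = v
  ... | no  _ = I z

  update-same : ∀ I y v → (I [ y ↦ v ]) y ≡ v
  update-same I y v with y ≟ y
  ... | yes _   = refl
  ... | no  y≢y = ⊥-elim (y≢y refl)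

  update-other : ∀ I {y z} v → z ≢ y → (I [ y ↦ v ]) z ≡ I z
  update-other I {y} {z} v z≢y with z ≟ y
  ... | yes z≡y = ⊥-elim (z≢y z≡y)
  ... | no  _   = refl

module _ {Atm : Set a} {Label : Set b} (M : Model Atm ℓ) where
  open Model M

  private
    Sat : (Label → W) → LFormula Atm Label → Set ℓ
    Sat = Satisfies M

  AgreeOff : Label → (I J : Label → W) → Set _
  AgreeOff y I J = ∀ {z} → z ≢ y → I z ≡ J z

  -- Every label read off `F` occurs in `F`, so it differs from `y` and gets the same world under
  -- `I` and `J`.
  Satisfies-agree : ∀ {y I J} → AgreeOff y I J →
                    ∀ F → ¬ y OccursIn F → Sat I F → Sat J F
  Satisfies-agree I≡J (x ∶ A) y∉F =
    subst ⟦ A ⟧ (I≡J λ { refl → y∉F label })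
  Satisfies-agree I≡J (x ⟶[ A ] z) y∉F =
    subst₂ (λ s t → f s ⟦ A ⟧ t)
      (I≡J λ { refl → y∉F source })
      (I≡J λ { refl → y∉F target })

  All-Satisfies-agree : ∀ {y I J Γ} → AgreeOff y I J → y ∉labels Γ →
                        All (Sat I) Γ → All (Sat J) Γ
  All-Satisfies-agree I≡J y∉Γ []       = []
  All-Satisfies-agree I≡J y∉Γ (p ∷ ps) =
    Satisfies-agree I≡J _ (y∉Γ ∘ here) p ∷ All-Satisfies-agree I≡J (y∉Γ ∘ there) ps

  Any-Satisfies-agree : ∀ {y I J Δ} → AgreeOff y I J → y ∉labels Δ →
                        Any (Sat I) Δ → Any (Sat J) Δ
  Any-Satisfies-agree I≡J y∉Δ (here p)  = here (Satisfies-agree I≡J _ (y∉Δ ∘ here) p)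
  Any-Satisfies-agree I≡J y∉Δ (there p) = there (Any-Satisfies-agree I≡J (y∉Δ ∘ there) p)

  -- With no side formulas, any world may be chosen for `u`; a constant interpretation does this.
  valid⇒⊆ : ∀ {u : Label} {A B} → ValidInModel M (u ∶ A ∷ [] ⊢ u ∶ B ∷ []) → ⟦ A ⟧ ⊆ ⟦ B ⟧
  valid⇒⊆ valid {w} w∈A with valid (const w) (w∈A ∷ [])
  ... | here w∈B = w∈B

  condID : ∀ {S} → HasID S → ModelOf M S → CondID M
  condID ID    = λ c → c
  condID ID+MP = proj₂

  condMP : ∀ {S} → HasMP S → ModelOf M S → CondMP M
  condMP MP    = λ c → c
  condMP ID+MP = proj₁

  module Soundness (em : ExcludedMiddle ℓ) (_≟_ : DecidableEquality Label)
                   {S : System} (M∈S : ModelOf M S) where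
    open Update _≟_ {W}

    sound : ∀ {σ} → Derivable S σ → ValidInModel M σ
    sound (exch Γ↭Γ′ Δ↭Δ′ d) I γ = Any-resp-↭ Δ↭Δ′ (sound d I (All-resp-↭ (↭-sym Γ↭Γ′) γ))
    sound ax I (p ∷ γ) = here p
    sound a⊥ I (() ∷ γ)
    sound (weakL d) I (p ∷ γ) = sound d I γ
    sound (weakR d) I γ = there (sound d I γ)
    sound (contrL d) I (p ∷ γ) = sound d I (p ∷ p ∷ γ)
    sound (contrR d) I γ with sound d I γ
    ... | here p  = here p
    ... | there δ = δ
    -- Implication is read as a union with a complement, so a side must be chosen before the premise
    -- can be applied.
    sound (⊃R {x = x} {A = A} d) I γ with em {⟦ A ⟧ (I x)}
    ... | no  x∉A = here (inj₁ x∉A)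
    ... | yes x∈A with sound d I (x∈A ∷ γ)
    ...   | here x∈B = here (inj₂ x∈B)
    ...   | there δ  = there δ
    sound (⊃L d e) I (inj₂ x∈B ∷ γ) = sound e I (x∈B ∷ γ)
    sound (⊃L d e) I (inj₁ x∉A ∷ γ) with sound d I γ
    ... | here x∈A = ⊥-elim (x∉A x∈A)
    ... | there δ  = δ
    sound (eq {x = x} d e) I (p ∷ γ) =
      here (proj₁ (f-cong (I x) (valid⇒⊆ (sound d) , valid⇒⊆ (sound e))) p)
    sound (⇒L d e) I (x∈A⇒B ∷ γ) with sound d I γ
    ... | here p  = sound e I (x∈A⇒B p ∷ γ)
    ... | there δ = δ
    sound (⇒R {Γ} {Δ} {x} {y} {A} {B} y∉Γ y∉Δ y≢x d) I γ
      -- Decided before any successor `v` is picked: the premise may answer with `Δ` for one `v` and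
      -- with `B` for another, while the conclusion needs one uniform answer.
      with any? (λ F → em {Sat I F}) Δ
    ... | yes δ = there δ
    ... | no ¬δ = here x∈A⇒B
      where
      x∈A⇒B : f (I x) ⟦ A ⟧ ⊆ ⟦ B ⟧
      x∈A⇒B {v} v∈f with sound d (I [ y ↦ v ]) (x⟶y ∷ All-Satisfies-agree I≡J y∉Γ γ)
        where
        I≡J : AgreeOff y I (I [ y ↦ v ])
        I≡J z≢y = sym (update-other I v z≢y)

        x⟶y : Sat (I [ y ↦ v ]) (x ⟶[ A ] y)
        x⟶y = subst₂ (λ s t → f s ⟦ A ⟧ t)
                (I≡J (y≢x ∘ sym)) (sym (update-same I y v)) v∈f
      ... | here y∈B = subst ⟦ B ⟧ (update-same I y v) y∈B
      -- Since `y` is fresh for `Δ`, a formula of `Δ` true after the update was already true under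
      -- `I`.
      ... | there δ  = ⊥-elim (¬δ (Any-Satisfies-agree (update-other I v) y∉Δ δ))
    sound (id {x = x} {A = A} h d) I (p ∷ γ) = sound d I (condID h M∈S (I x) A p ∷ γ)
    sound (mp {x = x} {A = A} h d) I γ with sound d I γ
    ... | here x∈A = here (condMP h M∈S (I x) A x∈A)
    ... | there δ  = there δ

theorem3p5 : {a b ℓ : Level} →
    ExcludedMiddle ℓ →
    (Atm : Set a) (Label : Set b) → Label ↔ ℕ →
    (S : System) (Γ Δ : List (LFormula Atm Label)) →
    Derivable S (Γ ⊢ Δ) → ValidIn ℓ S (Γ ⊢ Δ)
-- Updating `I` at one label requires comparing labels; that decision is pulled back from `ℕ`.
theorem3p5 em Atm Label Label↔ℕ S Γ Δ d M M∈S =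
  Soundness.sound M em (via-injection (↔⇒↣ Label↔ℕ) ℕ._≟_) M∈S d
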